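{- In the finite-metric, instantaneous-movement, unit-waiting online service model with per-batch maximum delay described in the context, on every finite metric space $(X,d)$ with any initial server position $s_0\in X$ and every finite input, $$\operatorname{OPT}_{\mathrm{auto}}=\operatorname{OPT}_{\mathrm{elective}},$$ where $\operatorname{OPT}_{\mathrm{auto}}$ and $\operatorname{OPT}_{\mathrm{elective}}$ are the offline optimal values under automatic and elective service, respectively.
   Context: Model. $(X,d)$ is a finite metric space and $s_0\in X$ is the initial server position. An input is a finite set of request occurrences; each request $q$ has an arrival time $a(q)\ge 0$ and a location $x(q)\in X$ (distinct occurrences remain distinct even when they share arrival time and location). An arrival epoch is the set of all requests sharing one arrival time. A walk $P=(v_0,\ldots,v_\ell)$ in $X$ ($\ell\ge 0$) is executed instantaneously at one time, visits its listed vertices, and has length $\operatorname{len}(P)=\sum_i d(v_{i-1},v_i)$. A schedule is a finite sequence of atomic actions with nondecreasing timestamps. At time $t$ the complete epoch arriving at $t$ is processed first; then one action at $t$ performs a finite ordered sequence of walks (components), and no further arrival is processed until the action ends. The first walk starts at $s_0$ and every later one starts where its predecessor ended; the server stays put between actions. A component walk $P$ at time $t$ during which a nonempty set $B$ of pending (arrived, not yet served) requests is served is one service event of cost $\operatorname{len}(P)+\max_{q\in B}(t-a(q))$; a component serving no request costs $\operatorname{len}(P)$. The cost of a schedule is the sum of these costs. Every request must eventually be served. Elective service: a pending request may be included in $B$ only if its location is visited by $P$, but the server may visit or occupy a location without serving the requests there. Automatic service: every pending request whose location is visited by a walk is served in that event (so a nominally pure movement becomes a service event if it visits a pending request), and a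 request arriving at the current server position is served immediately (zero movement and zero delay). The optimal value under each semantics is the infimum of the cost over all feasible schedules. -}

module Defs where

open import Algebra.Bundles using (CommutativeRing)
open import Algebra.Structures using (IsCommutativeRing)
open import Data.Bool.Base using (if_then_else_; true)
open import Data.Empty using (⊥)
open import Data.Fin.Base using (Fin)
open import Data.Fin.Properties using () renaming (_≟_ to _≟ᶠ_)
open import Data.Fin.Subset using (Subset; _∈_; _∉_; _∪_) renaming (⊥ to ∅)
open import Data.Fin.Subset.Properties using (_∈?_; ∉⊥; x∈p∪q⁺)
open import Data.List.Base using (List; []; _∷_; map; filter; allFin)
import Data.List.Membership.Propositional as List
open import Data.List.Membership.Propositional.Properties using (∈-allFin; ∈-map⁺)
open import Data.List.NonEmpty.Base using (List⁺; _∷_; head; toList)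
open import Data.List.Relation.Unary.All using (All; []; _∷_)
open import Data.List.Relation.Unary.All.Properties using (all-filter)
open import Data.List.Relation.Unary.Any using (there)
import Data.List.Extrema as Extrema
open import Data.Nat.Base using (ℕ)
open import Data.Product.Base using (∃; _×_; _,_; proj₁; proj₂)
open import Data.Sum.Base using (_⊎_; inj₁; inj₂)
open import Data.Unit.Base using (⊤; tt)
open import Data.Vec.Base using (tabulate)
open import Data.Vec.Properties using (lookup⇒[]=; []=⇒lookup; lookup∘tabulate)
open import Function.Bundles using (_↔_; module Inverse)
open import Function.Metric.Structures using (IsGeneralMetric)
open import Function.Properties.Inverse using (Inverse⇒Injection)
open import Level using (0ℓ)
open import Relation.Binary.Bundles using (DecTotalOrder)
open import Relation.Binary.Core using (Rel)
open import Relation.Binary.Definitions using (DecidableEquality)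
open import Relation.Binary.PropositionalEquality
  using (_≡_; refl; sym; trans; subst)
open import Relation.Binary.Structures using (IsDecTotalOrder)
open import Relation.Nullary using (Dec; yes; no; does; ¬_)
open import Relation.Nullary.Decidable using (¬?; via-injection; dec-true)

LowerBound : {A : Set} → Rel A 0ℓ → (A → Set) → A → Set
LowerBound _≤_ P w = ∀ x → P x → w ≤ x

IsInfimum : {A : Set} → Rel A 0ℓ → (A → Set) → A → Set
IsInfimum _≤_ P v =
  LowerBound _≤_ P v × (∀ w → LowerBound _≤_ P w → w ≤ v)

-- The classical axioms of a Dedekind-complete ordered field, which
-- determine the real line up to unique isomorphism.  The order is decidable
-- because the reals are meant classically.
record Reals : Set₁ where
  infix  4 _≈_ _≤_
  infixl 6 _+_
  infixl 7 _*_
  infix  8 -_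
  field
    Carrier           : Set
    _≈_               : Rel Carrier 0ℓ
    _≤_               : Rel Carrier 0ℓ
    _+_ _*_           : Carrier → Carrier → Carrier
    -_                : Carrier → Carrier
    0# 1#             : Carrier
    isCommutativeRing : IsCommutativeRing _≈_ _+_ _*_ -_ 0# 1#
    1≉0               : ¬ (1# ≈ 0#)
    inverse           : ∀ x → ¬ (x ≈ 0#) → ∃ λ y → (x * y) ≈ 1#
    isDecTotalOrder   : IsDecTotalOrder _≈_ _≤_
    +-monoˡ-≤         : ∀ {x y} z → x ≤ y → (x + z) ≤ (y + z)
    *-nonNegative     : ∀ {x y} → 0# ≤ x → 0# ≤ y → 0# ≤ (x * y)
    complete          : (P : Carrier → Set) → ∃ P → ∃ (LowerBound _≤_ P) →
                        ∃ (IsInfimum _≤_ P)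

  infixl 6 _-_
  _-_ : Carrier → Carrier → Carrier
  x - y = x + (- y)

  commutativeRing : CommutativeRing 0ℓ 0ℓ
  commutativeRing = record { isCommutativeRing = isCommutativeRing }

  decTotalOrder : DecTotalOrder 0ℓ 0ℓ 0ℓ
  decTotalOrder = record { isDecTotalOrder = isDecTotalOrder }

  open DecTotalOrder decTotalOrder public
    using (_≤?_; totalOrder; module Eq; reflexive)
    renaming (refl to ≤-refl; trans to ≤-trans)
  open Extrema totalOrder public using (max; v≤max⁺; xs≤max)

  +-nonNegative : ∀ {x y} → 0# ≤ x → 0# ≤ y → 0# ≤ (x + y)
  +-nonNegative {x} {y} 0≤x 0≤y = ≤-trans 0≤y
    (≤-trans (reflexive (Eq.sym (+-identityˡ y))) (+-monoˡ-≤ y 0≤x))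
    where open CommutativeRing commutativeRing using (+-identityˡ)

  -‿nonNegative : ∀ {x y} → y ≤ x → 0# ≤ (x - y)
  -‿nonNegative {x} {y} y≤x =
    ≤-trans (reflexive (Eq.sym (-‿inverseʳ y))) (+-monoˡ-≤ (- y) y≤x)
    where open CommutativeRing commutativeRing using (-‿inverseʳ)

record FiniteMetricSpace (ℝ : Reals) : Set₁ where
  open Reals ℝ using (Carrier; _≈_; _≤_; 0#; _+_)
  field
    Point       : Set
    size        : ℕ
    enumeration : Point ↔ Fin size
    d           : Point → Point → Carrier
    isMetric    : IsGeneralMetric _≡_ _≈_ _≤_ 0# _+_ d

  open IsGeneralMetric isMetric public using (nonNegative)

  _≟_ : DecidableEquality Point
  _≟_ = via-injection (Inverse⇒Injection enumeration) _≟ᶠ_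

  points : List Point
  points = map (Inverse.from enumeration) (allFin size)

  ∈-points : ∀ x → x List.∈ points
  ∈-points x = subst (List._∈ points) (Inverse.strictlyInverseʳ enumeration x)
    (∈-map⁺ (Inverse.from enumeration) (∈-allFin (Inverse.to enumeration x)))

-- Request occurrences are indexed by Fin count, so two of them may share
-- arrival time and location.
record Input (ℝ : Reals) (M : FiniteMetricSpace ℝ) : Set where
  open Reals ℝ using (Carrier; _≤_; 0#)
  open FiniteMetricSpace M using (Point)
  field
    count     : ℕ
    arrival   : Fin count → Carrier
    arrival≥0 : ∀ q → 0# ≤ arrival q
    location  : Fin count → Point

data Semantics : Set where
  elective automatic : Semantics

module Model (ℝ : Reals) (M : FiniteMetricSpace ℝ)
             (s₀ : FiniteMetricSpace.Point M) (I : Input ℝ M) where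

  open Reals ℝ
  open FiniteMetricSpace M
  open Input I

  Request : Set
  Request = Fin count

  Walk : Set
  Walk = List⁺ Point

  length′ : Point → List Point → Carrier
  length′ v []       = 0#
  length′ v (w ∷ ws) = d v w + length′ w ws

  len : Walk → Carrier
  len (v ∷ vs) = length′ v vs

  end′ : Point → List Point → Point
  end′ v []       = v
  end′ v (w ∷ ws) = end′ w ws

  end : Walk → Point
  end (v ∷ vs) = end′ v vs

  Visits : Walk → Point → Set
  Visits P x = x List.∈ toList P

  -- The batch is the set B of requests served during the walk; it is empty
  -- for a pure movement.  Under automatic service it is recorded too, but
  -- feasibility below leaves no choice for it.
  record Component : Set where
    constructor component
    field
      walk  : Walk
      batch : Subset count
  open Component public

  record Action : Set where
    constructor action
    field
      time       : Carrier
      components : List Component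
  open Action public

  Schedule : Set
  Schedule = List Action

  -- Cost.  Automatic service on arrival is free and so does not appear.

  maxDelay : Carrier → List Request → Carrier
  maxDelay t []       = 0#
  maxDelay t (q ∷ qs) = max (t - arrival q) (map (λ r → t - arrival r) qs)

  elements : Subset count → List Request
  elements B = filter (_∈? B) (allFin count)

  componentCost : Carrier → Component → Carrier
  componentCost t c = len (walk c) + maxDelay t (elements (batch c))

  componentsCost : Carrier → List Component → Carrier
  componentsCost t []       = 0#
  componentsCost t (c ∷ cs) = componentCost t c + componentsCost t cs

  cost : Schedule → Carrier
  cost []       = 0#
  cost (α ∷ αs) = componentsCost (time α) (components α) + cost αs

  endOf : Point → List Component → Point
  endOf p []       = p
  endOf p (c ∷ cs) = endOf (end (walk c)) cs

  -- The position at which an epoch arriving at time τ finds the server: all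
  -- actions with timestamp < τ have been performed, whereas actions at τ
  -- itself come after the epoch.
  positionBefore : Point → Schedule → Carrier → Point
  positionBefore p []       τ = p
  positionBefore p (α ∷ αs) τ =
    if does (τ ≤? time α)
    then p
    else positionBefore (endOf p (components α)) αs τ

  ServedOnArrival : Semantics → Schedule → Request → Set
  ServedOnArrival elective  s q = ⊥
  ServedOnArrival automatic s q =
    location q ≡ positionBefore s₀ s (arrival q)

  -- S is the set of requests served in earlier components.
  record Pending (σ : Semantics) (s : Schedule) (t : Carrier)
                 (S : Subset count) (q : Request) : Set where
    constructor pending
    field
      arrived      : arrival q ≤ t
      notOnArrival : ¬ ServedOnArrival σ s q
      notServed    : q ∉ S

  CanServe : Semantics → Schedule → Carrier → Subset count → Walk →
             Request → Set
  CanServe σ s t S P q = Pending σ s t S q × Visits P (location q)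

  Forced : Semantics → Schedule → Carrier → Subset count → Component → Set
  Forced elective  s t S c = ⊤
  Forced automatic s t S c =
    ∀ q → CanServe automatic s t S (walk c) q → q ∈ batch c

  -- Performs σ s t p S cs p′ S′ : at time t the components cs take the server
  -- from p to p′ and enlarge the set of served requests from S to S′.
  data Performs (σ : Semantics) (s : Schedule) (t : Carrier) :
         Point → Subset count → List Component → Point → Subset count → Set
         where
    []  : ∀ {p S} → Performs σ s t p S [] p S
    _∷_ : ∀ {p S c cs p′ S′} →
          head (walk c) ≡ p
          × (∀ q → q ∈ batch c → CanServe σ s t S (walk c) q)
          × Forced σ s t S c →
          Performs σ s t (end (walk c)) (S ∪ batch c) cs p′ S′ →
          Performs σ s t p S (c ∷ cs) p′ S′

  -- Executes σ s τ p S αs S′ : the actions αs, none before τ, are performed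
  -- from position p and enlarge the set of served requests from S to S′.
  data Executes (σ : Semantics) (s : Schedule) :
         Carrier → Point → Subset count → List Action → Subset count → Set
         where
    []  : ∀ {τ p S} → Executes σ s τ p S [] S
    _∷_ : ∀ {τ p S α αs p′ S′ S″} →
          τ ≤ time α × Performs σ s (time α) p S (components α) p′ S′ →
          Executes σ s (time α) p′ S′ αs S″ →
          Executes σ s τ p S (α ∷ αs) S″

  Feasible : Semantics → Schedule → Set
  Feasible σ s = ∃ λ S →
    Executes σ s 0# s₀ ∅ s S × (∀ q → ServedOnArrival σ s q ⊎ q ∈ S)

  FeasibleCost : Semantics → Carrier → Set
  FeasibleCost σ v = ∃ λ s → Feasible σ s × v ≈ cost s

  -- The infimum exists: the feasible costs are bounded below by 0 ...

  length′-nonNegative : ∀ v vs → 0# ≤ length′ v vs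
  length′-nonNegative v []       = ≤-refl
  length′-nonNegative v (w ∷ ws) =
    +-nonNegative nonNegative (length′-nonNegative w ws)

  maxDelay-nonNegative : ∀ t {qs} → All (λ q → arrival q ≤ t) qs →
                         0# ≤ maxDelay t qs
  maxDelay-nonNegative t []                = ≤-refl
  maxDelay-nonNegative t {q ∷ qs} (a ∷ as) =
    v≤max⁺ _ (map (λ r → t - arrival r) qs) (inj₁ (-‿nonNegative a))

  componentsCost-nonNegative : ∀ {σ s t p S cs p′ S′} →
    Performs σ s t p S cs p′ S′ → 0# ≤ componentsCost t cs
  componentsCost-nonNegative [] = ≤-refl
  componentsCost-nonNegative {t = t} {cs = c ∷ _} ((_ , ok , _) ∷ ps) =
    +-nonNegative
      (+-nonNegative
        (length′-nonNegative (head (walk c)) (List⁺.tail (walk c)))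
        (maxDelay-nonNegative t
          (mapAll (λ {q} q∈B → Pending.arrived (proj₁ (ok q q∈B)))
                  (all-filter (_∈? batch c) (allFin count)))))
      (componentsCost-nonNegative ps)
    where open import Data.List.Relation.Unary.All using () renaming (map to mapAll)

  cost-nonNegative : ∀ {σ s τ p S αs S′} →
                     Executes σ s τ p S αs S′ → 0# ≤ cost αs
  cost-nonNegative []             = ≤-refl
  cost-nonNegative ((_ , p) ∷ es) =
    +-nonNegative (componentsCost-nonNegative p) (cost-nonNegative es)

  bounded : ∀ σ → ∃ (LowerBound _≤_ (FeasibleCost σ))
  bounded σ = 0# , λ { v (s , (_ , exec , _) , v≈) →
    ≤-trans (cost-nonNegative exec) (reflexive (Eq.sym v≈)) }

  -- ... and there is one: wait for the last arrival, then walk through the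
  -- whole space.

  servedOnArrival? : ∀ σ s q → Dec (ServedOnArrival σ s q)
  servedOnArrival? elective  s q = no λ ()
  servedOnArrival? automatic s q =
    location q ≟ positionBefore s₀ s (arrival q)

  module Tour (σ : Semantics) where

    T : Carrier
    T = max 0# (map arrival (allFin count))

    tourWalk : Walk
    tourWalk = s₀ ∷ points

    -- The batch depends on the server's position at arrivals, which is s₀
    -- throughout and is computed here from a schedule with the same movement.
    tourWith : Subset count → Schedule
    tourWith B = action T (component tourWalk B ∷ []) ∷ []

    late? : ∀ q → Dec (¬ ServedOnArrival σ (tourWith ∅) q)
    late? q = ¬? (servedOnArrival? σ (tourWith ∅) q)

    B : Subset count
    B = tabulate (λ q → does (late? q))

    tour : Schedule
    tour = tourWith B

    sameFor : ∀ σ′ q → ServedOnArrival σ′ tour q ≡ ServedOnArrival σ′ (tourWith ∅) q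
    sameFor elective  q = refl
    sameFor automatic q = refl

    same : ∀ q → ServedOnArrival σ tour q ≡ ServedOnArrival σ (tourWith ∅) q
    same = sameFor σ

    ∈B⁺ : ∀ {q} → ¬ ServedOnArrival σ tour q → q ∈ B
    ∈B⁺ {q} ¬on = lookup⇒[]= q B (trans (lookup∘tabulate _ q)
      (dec-true (late? q) (subst ¬_ (same q) ¬on)))

    ∈B⁻ : ∀ {q} → q ∈ B → ¬ ServedOnArrival σ tour q
    ∈B⁻ {q} q∈B = subst ¬_ (sym (same q)) (invert (late? q)
      (trans (sym (lookup∘tabulate _ q)) ([]=⇒lookup q∈B)))
      where
      invert : {P : Set} (P? : Dec P) → does P? ≡ true → P
      invert (yes p) _ = p

    arrived≤T : ∀ q → arrival q ≤ T
    arrived≤T q = lookup (xs≤max 0# (map arrival (allFin count)))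
                         (∈-map⁺ arrival (∈-allFin q))
      where open import Data.List.Relation.Unary.All using (lookup)

    forced : ∀ σ′ → σ′ ≡ σ → Forced σ′ tour T ∅ (component tourWalk B)
    forced elective  _    = tt
    forced automatic refl q (pending _ ¬on _ , _) = ∈B⁺ ¬on

    feasible : Feasible σ tour
    feasible =
      ∅ ∪ B
      , (v≤max⁺ 0# (map arrival (allFin count)) (inj₁ ≤-refl)
        , (refl
          , (λ q q∈B → pending (arrived≤T q) (∈B⁻ q∈B) ∉⊥
                       , there (∈-points (location q)))
          , forced σ refl) ∷ []) ∷ []
      , λ q → decide q (servedOnArrival? σ tour q)
      where
      decide : ∀ q → Dec (ServedOnArrival σ tour q) →
               ServedOnArrival σ tour q ⊎ q ∈ (∅ ∪ B)
      decide q (yes on) = inj₁ on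
      decide q (no ¬on) = inj₂ (x∈p∪q⁺ (inj₂ (∈B⁺ ¬on)))

  inhabited : ∀ σ → ∃ (FeasibleCost σ)
  inhabited σ = cost (Tour.tour σ) , Tour.tour σ , Tour.feasible σ , Eq.refl

  optimum : ∀ σ → ∃ (IsInfimum _≤_ (FeasibleCost σ))
  optimum σ = complete (FeasibleCost σ) (inhabited σ) (bounded σ)

  OPT : Semantics → Carrier
  OPT σ = proj₁ (optimum σ)

{-# OPTIONS --safe #-}

-- Automatic to elective: a request that automatic service picks up on arrival
-- is served electively by a trivial walk inserted at its arrival time, at no
-- cost.
--
-- Elective to automatic: postpone all movement until the first action after
-- which the elective schedule has served everything that has arrived, and then
-- perform the postponed walks as a single one.  Everything unserved so far lies
-- on that walk, so forced service has no choice left.  The intervals from the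
-- oldest arrival of a batch to its service, for the merged events, cover the
-- time from the oldest postponed request until now, so the sum of the elective
-- delays pays for the single delay of the merged event.
module Submission where

open import Algebra.Bundles using (CommutativeRing)
import Algebra.Properties.CommutativeSemigroup as CommutativeSemigroupProperties
open import Data.Bool.Base using (if_then_else_)
open import Data.Fin.Properties using (all?; ¬∀⟶∃¬)
open import Data.Fin.Subset using (Subset; _∈_; _∉_; _⊆_; _∪_; ⁅_⁆)
  renaming (⊥ to ∅)
open import Data.Fin.Subset.Properties
  using (_∈?_; ∉⊥; x∈p∪q⁺; x∈p∪q⁻; p⊆p∪q; x∈⁅x⁆; x∈⁅y⁆⇒x≡y; ∪-assoc; ∪-comm)
open import Data.List.Base using (List; []; _∷_; _++_; map; concatMap; allFin)
open import Data.List.Membership.Propositional.Properties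
  using (∈-allFin; ∈-filter⁺; ∈-filter⁻; ∈-map⁺; ∈-++⁺ʳ; ∈-++⁺ˡ)
import Data.List.Membership.Propositional as List
import Data.List.Extrema as Extrema
open import Data.List.NonEmpty.Base using (_∷_; tail)
import Data.List.Relation.Unary.All as All
import Data.List.Relation.Unary.All.Properties as All
open import Data.List.Relation.Unary.Any using (here; there)
open import Data.Product.Base using (∃; _×_; _,_; proj₁; proj₂)
open import Data.Sum.Base using (_⊎_; inj₁; inj₂; [_,_]′)
open import Data.Unit.Base using (tt)
open import Data.Vec.Base using (tabulate)
open import Data.Vec.Properties using (lookup⇒[]=; []=⇒lookup; lookup∘tabulate)
open import Function.Base using (_∘_)
open import Relation.Binary.Bundles using (DecTotalOrder)
import Relation.Binary.Reasoning.PartialOrder as PartialOrderReasoning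
open import Relation.Binary.PropositionalEquality
  using (_≡_; refl; sym; trans; cong; subst)
open import Relation.Nullary using (Dec; yes; no; does; ¬_; contradiction)
open import Relation.Nullary.Decidable
  using (¬?; _×-dec_; _→-dec_; dec-true; decidable-stable)
open import Relation.Unary using (Decidable)

open import Defs

-- Subsets cut out by decidable predicates.

module Subsets where

  ⟦_⟧ : ∀ {n} {P : _ → Set} → Decidable P → Subset n
  ⟦ P? ⟧ = tabulate (does ∘ P?)

  ∈⟦⟧⁺ : ∀ {n} {P : _ → Set} (P? : Decidable P) {q} → P q → q ∈ ⟦_⟧ {n} P?
  ∈⟦⟧⁺ P? {q} p = lookup⇒[]= q _ (trans (lookup∘tabulate _ q) (dec-true (P? q) p))

  ∈⟦⟧⁻ : ∀ {n} {P : _ → Set} (P? : Decidable P) {q} → q ∈ ⟦_⟧ {n} P? → P q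
  ∈⟦⟧⁻ P? {q} q∈ with P? q | trans (sym (lookup∘tabulate (does ∘ P?) q)) ([]=⇒lookup q∈)
  ... | yes p | _ = p
  ... | no _  | ()

  ∪-swapʳ : ∀ {n} (p q r : Subset n) → (p ∪ q) ∪ r ≡ (p ∪ r) ∪ q
  ∪-swapʳ p q r = trans (∪-assoc p q r)
    (trans (cong (p ∪_) (∪-comm q r)) (sym (∪-assoc p r q)))

-- Additive inequalities in an ordered field.

module OrderedArithmetic (ℝ : Reals) where

  open Reals ℝ
  open CommutativeRing commutativeRing public
    using (+-congˡ; +-congʳ; +-comm; +-assoc; +-identityˡ; +-identityʳ; -‿inverseʳ; -‿inverseˡ)
  open CommutativeSemigroupProperties
    (CommutativeRing.+-commutativeSemigroup commutativeRing) public
    using (interchange)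
  open DecTotalOrder decTotalOrder public using (antisym; total)
  open PartialOrderReasoning (DecTotalOrder.poset decTotalOrder) public

  +-mono-≤ : ∀ {w x y z} → w ≤ x → y ≤ z → (w + y) ≤ (x + z)
  +-mono-≤ {w} {x} {y} {z} w≤x y≤z = begin
    w + y  ≤⟨ +-monoˡ-≤ y w≤x ⟩
    x + y  ≈⟨ +-comm x y ⟩
    y + x  ≤⟨ +-monoˡ-≤ x y≤z ⟩
    z + x  ≈⟨ +-comm z x ⟩
    x + z  ∎

  +-monoʳ-≤ : ∀ x {y z} → y ≤ z → (x + y) ≤ (x + z)
  +-monoʳ-≤ x = +-mono-≤ ≤-refl

  x≤x+y : ∀ x {y} → 0# ≤ y → x ≤ (x + y)
  x≤x+y x {y} 0≤y = begin
    x       ≈⟨ +-identityʳ x ⟨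
    x + 0#  ≤⟨ +-monoʳ-≤ x 0≤y ⟩
    x + y   ∎

  x≤y+x : ∀ {y} x → 0# ≤ y → x ≤ (y + x)
  x≤y+x {y} x 0≤y = ≤-trans (x≤x+y x 0≤y) (reflexive (+-comm x y))

  x≤y+z⇒x-y≤z : ∀ {x y z} → x ≤ (y + z) → (x - y) ≤ z
  x≤y+z⇒x-y≤z {x} {y} {z} x≤y+z = begin
    x - y              ≤⟨ +-monoˡ-≤ (- y) x≤y+z ⟩
    (y + z) - y        ≈⟨ +-congʳ (+-comm y z) ⟩
    (z + y) - y        ≈⟨ +-assoc z y (- y) ⟩
    z + (y - y)        ≈⟨ +-congˡ (-‿inverseʳ y) ⟩
    z + 0#             ≈⟨ +-identityʳ z ⟩
    z                  ∎

  x-y≤z⇒x≤y+z : ∀ {x y z} → (x - y) ≤ z → x ≤ (y + z)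
  x-y≤z⇒x≤y+z {x} {y} {z} x-y≤z = begin
    x                  ≈⟨ +-identityʳ x ⟨
    x + 0#             ≈⟨ +-congˡ (-‿inverseˡ y) ⟨
    x + (- y + y)      ≈⟨ +-assoc x (- y) y ⟨
    (x - y) + y        ≤⟨ +-monoˡ-≤ y x-y≤z ⟩
    z + y              ≈⟨ +-comm z y ⟩
    y + z              ∎

module _ (ℝ : Reals) (M : FiniteMetricSpace ℝ)
         (s₀ : FiniteMetricSpace.Point M) (I : Input ℝ M) where

  open Subsets
  open Reals ℝ
  open OrderedArithmetic ℝ
  open FiniteMetricSpace M using (Point)
  open Input I
  open Model ℝ M s₀ I

  -- Concatenation of walks, and the delay of a batch.

  length′-++ : ∀ p vs ws → length′ p (vs ++ ws) ≈ (length′ p vs + length′ (end′ p vs) ws)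
  length′-++ p []       ws = Eq.sym (+-identityˡ _)
  length′-++ p (v ∷ vs) ws =
    Eq.trans (+-congˡ (length′-++ v vs ws)) (Eq.sym (+-assoc _ _ _))

  end′-++ : ∀ p vs ws → end′ p (vs ++ ws) ≡ end′ (end′ p vs) ws
  end′-++ p []       ws = refl
  end′-++ p (v ∷ vs) ws = end′-++ v vs ws

  end-visited : ∀ p vs → Visits (p ∷ vs) (end′ p vs)
  end-visited p []       = here refl
  end-visited p (v ∷ vs) = there (end-visited v vs)

  visits-++ˡ : ∀ {p vs ws x} → Visits (p ∷ vs) x → Visits (p ∷ vs ++ ws) x
  visits-++ˡ = ∈-++⁺ˡ

  -- Concatenation drops the start of the second walk; that vertex is still visited, as the end of
  -- the first.
  visits-++ʳ : ∀ p vs {ws x} → Visits (end′ p vs ∷ ws) x → Visits (p ∷ vs ++ ws) x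
  visits-++ʳ p vs (here refl) = visits-++ˡ (end-visited p vs)
  visits-++ʳ p vs (there x∈)  = ∈-++⁺ʳ (p ∷ vs) x∈

  maxDelay-least : ∀ {t C} qs → 0# ≤ C → (∀ {q} → q List.∈ qs → (t - arrival q) ≤ C) →
                   maxDelay t qs ≤ C
  maxDelay-least []       0≤C _   = 0≤C
  maxDelay-least (q ∷ qs) 0≤C age≤C = Extrema.max≤v⁺ totalOrder (age≤C (here refl))
    (All.map⁺ (All.tabulate (age≤C ∘ there)))

  age≤maxDelay : ∀ t {q qs} → q List.∈ qs → (t - arrival q) ≤ maxDelay t qs
  age≤maxDelay t {qs = _ ∷ qs} (here refl) =
    Extrema.⊥≤max totalOrder _ (map (λ r → t - arrival r) qs)
  age≤maxDelay t {qs = _ ∷ qs} (there q∈)  =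
    All.lookup (xs≤max _ (map (λ r → t - arrival r) qs)) (∈-map⁺ _ q∈)

  ∈-elements⁺ : ∀ {q B} → q ∈ B → q List.∈ elements B
  ∈-elements⁺ {q} {B} = ∈-filter⁺ (_∈? B) (∈-allFin q)

  ∈-elements⁻ : ∀ {q B} → q List.∈ elements B → q ∈ B
  ∈-elements⁻ {B = B} = proj₂ ∘ ∈-filter⁻ (_∈? B) {xs = allFin count}

  -- Each component starts where its predecessor ended, so without the starting vertices the
  -- components that begin at `p` form the single walk `p ∷ trail cs`.
  trail : List Component → List Point
  trail = concatMap (tail ∘ walk)

  delays : Carrier → List Component → Carrier
  delays t []       = 0#
  delays t (c ∷ cs) = maxDelay t (elements (batch c)) + delays t cs

  -- The effect of a single elective action.

  module _ {s : Schedule} {t : Carrier} where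

    performs-end : ∀ {p S cs p′ S′} → Performs elective s t p S cs p′ S′ →
                   end′ p (trail cs) ≡ p′
    performs-end []                                = refl
    performs-end (_∷_ {c = component (v ∷ vs) _} {cs} (refl , _) ps) =
      trans (end′-++ v vs (trail cs)) (performs-end ps)

    componentsCost-split : ∀ {p S cs p′ S′} → Performs elective s t p S cs p′ S′ →
      componentsCost t cs ≈ (length′ p (trail cs) + delays t cs)
    componentsCost-split [] = Eq.sym (+-identityˡ 0#)
    componentsCost-split (_∷_ {c = component (v ∷ vs) _} {cs} (refl , _) ps) =
      Eq.trans (+-congˡ (componentsCost-split ps))
        (Eq.trans (interchange _ _ _ _)
          (+-congʳ (Eq.sym (length′-++ v vs (trail cs)))))

    delays-nonNegative : ∀ {p S cs p′ S′} → Performs elective s t p S cs p′ S′ →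
                         0# ≤ delays t cs
    delays-nonNegative []               = ≤-refl
    delays-nonNegative ((_ , ok , _) ∷ ps) = +-nonNegative
      (maxDelay-nonNegative t
        (All.tabulate (λ q∈ → Pending.arrived (proj₁ (ok _ (∈-elements⁻ q∈))))))
      (delays-nonNegative ps)

    performs-mono : ∀ {p S cs p′ S′} → Performs elective s t p S cs p′ S′ → S ⊆ S′
    performs-mono []       q∈S = q∈S
    performs-mono (_ ∷ ps) q∈S = performs-mono ps (p⊆p∪q _ q∈S)

    -- The age of a newly served request is at most the delay of its own batch. That delay is one
    -- summand of `delays t cs`, and the other summands are nonnegative.
    performs-served : ∀ {p S cs p′ S′} → Performs elective s t p S cs p′ S′ →
      ∀ {q} → q ∈ S′ → q ∈ S ⊎
        (arrival q ≤ t × Visits (p ∷ trail cs) (location q) × t ≤ (arrival q + delays t cs))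
    performs-served []  q∈S = inj₁ q∈S
    performs-served {S = S} (_∷_ {c = component (v ∷ vs) B} (refl , ok , _) ps) {q} q∈S′
      with performs-served ps q∈S′
    ... | inj₂ (a≤t , vis , age) = inj₂
      (a≤t , visits-++ʳ v vs vis
      , ≤-trans age (+-monoʳ-≤ _ (x≤y+x _
          (maxDelay-nonNegative t
            (All.tabulate (λ q∈ → Pending.arrived (proj₁ (ok _ (∈-elements⁻ q∈)))))))))
    ... | inj₁ q∈S∪B with x∈p∪q⁻ S B q∈S∪B
    ...   | inj₁ q∈S = inj₁ q∈S
    ...   | inj₂ q∈B with ok q q∈B
    ...     | pending a≤t _ _ , vis = inj₂
      (a≤t , visits-++ˡ vis
      , ≤-trans (x-y≤z⇒x≤y+z (age≤maxDelay t (∈-elements⁺ q∈B)))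
          (+-monoʳ-≤ _ (x≤x+y _ (delays-nonNegative ps))))

  -- From elective to automatic service

  due? : ∀ t D → Decidable (λ q → arrival q ≤ t × q ∉ D)
  due? t D q = (arrival q ≤? t) ×-dec ¬? (q ∈? D)

  -- The batch of a merged event. It is defined without mention of the walk, so that forced service
  -- is immediate; that the walk visits all of it is shown separately.
  due : Carrier → Subset count → Subset count
  due t D = ⟦ due? t D ⟧

  AllServed : Carrier → Subset count → Set
  AllServed t S = ∀ q → arrival q ≤ t → q ∈ S

  allServed? : ∀ t S → Dec (AllServed t S)
  allServed? t S = all? (λ q → (arrival q ≤? t) →-dec (q ∈? S))

  someUnserved : ∀ {t S} → ¬ AllServed t S → ∃ λ q → arrival q ≤ t × q ∉ S
  someUnserved {t} {S} ¬all
    with ¬∀⟶∃¬ count _ (λ q → (arrival q ≤? t) →-dec (q ∈? S)) ¬all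
  ... | q , ¬imp = q
    , decidable-stable (arrival q ≤? t) (λ a≰t → ¬imp (λ a≤t → contradiction a≤t a≰t))
    , (λ q∈S → ¬imp (λ _ → q∈S))

  -- lazy es p₀ vs D is the automatic schedule of a server that waits at p₀ and
  -- still owes the walk p₀ ∷ vs; D holds the requests it has already served,
  -- including those served on arrival, past or future.
  lazy : ∀ {s τ p S αs S″} → Executes elective s τ p S αs S″ →
         Point → List Point → Subset count → Schedule
  lazy [] p₀ vs D = []
  lazy (_∷_ {α = action t cs} {S′ = S′} _ es) p₀ vs D with allServed? t S′
  ... | yes _ = action t (component (p₀ ∷ vs ++ trail cs) (due t D) ∷ [])
              ∷ lazy es (end′ p₀ (vs ++ trail cs)) [] (D ∪ due t D)
  ... | no _  = lazy es p₀ (vs ++ trail cs) D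

  -- `D` affects only the batches: when to move depends on the elective schedule alone, and the owed
  -- walk on its trails.
  lazy-position : ∀ {s τ p S αs S″} (es : Executes elective s τ p S αs S″) p₀ vs D D′ θ →
    positionBefore p₀ (lazy es p₀ vs D) θ ≡ positionBefore p₀ (lazy es p₀ vs D′) θ
  lazy-position [] p₀ vs D D′ θ = refl
  lazy-position (_∷_ {α = action t cs} {S′ = S′} _ es) p₀ vs D D′ θ with allServed? t S′
  ... | yes _ = cong (if does (θ ≤? t) then p₀ else_)
                  (lazy-position es (end′ p₀ (vs ++ trail cs)) [] _ _ θ)
  ... | no _  = lazy-position es p₀ (vs ++ trail cs) D D′ θ

  -- C is the sum of the elective delays since the lazy server last moved.  A
  -- request served electively but not lazily is older than some electively
  -- unserved one by at most C.
  record Deferred (τ C : Carrier) (S D : Subset count) (W : Walk) : Set where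
    field
      0≤C     : 0# ≤ C
      arrived : ∀ {q} → q ∈ S → arrival q ≤ τ
      visited : ∀ {q} → q ∈ S → q ∉ D → Visits W (location q)
      covered : ∀ {q} → q ∈ S → q ∉ D → ∃ λ u → u ∉ S × arrival u ≤ (arrival q + C)

  -- The invariant and the accounting over one elective action.

  module Step {s t p S cs p′ S′} (ps : Performs elective s t p S cs p′ S′)
              {τ C D p₀ vs} (inv : Deferred τ C S D (p₀ ∷ vs))
              (τ≤t : τ ≤ t) (at-p : end′ p₀ vs ≡ p) where

    open Deferred inv

    δ C′ : Carrier
    δ  = delays t cs
    C′ = C + δ

    vs′ : List Point
    vs′ = vs ++ trail cs

    0≤C′ : 0# ≤ C′
    0≤C′ = +-nonNegative 0≤C (delays-nonNegative ps)

    at-p′ : end′ p₀ vs′ ≡ p′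
    at-p′ = trans (end′-++ p₀ vs (trail cs))
      (trans (cong (λ r → end′ r (trail cs)) at-p) (performs-end ps))

    length-split : length′ p₀ vs′ ≈ (length′ p₀ vs + length′ p (trail cs))
    length-split = Eq.trans (length′-++ p₀ vs (trail cs))
      (+-congˡ (Eq.reflexive (cong (λ r → length′ r (trail cs)) at-p)))

    -- The credit, which is the length of the owed walk plus the accumulated delay, grows by exactly
    -- the cost of the elective action.
    budget : ∀ x → ((length′ p₀ vs′ + C′) + x)
                 ≈ ((length′ p₀ vs + C) + (componentsCost t cs + x))
    budget x = begin-equality
      (length′ p₀ vs′ + C′) + x
        ≈⟨ +-congʳ (+-congʳ length-split) ⟩
      ((length′ p₀ vs + length′ p (trail cs)) + C′) + x
        ≈⟨ +-congʳ (interchange _ _ _ _) ⟩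
      ((length′ p₀ vs + C) + (length′ p (trail cs) + δ)) + x
        ≈⟨ +-congʳ (+-congˡ (componentsCost-split ps)) ⟨
      ((length′ p₀ vs + C) + componentsCost t cs) + x
        ≈⟨ +-assoc _ _ _ ⟩
      (length′ p₀ vs + C) + (componentsCost t cs + x) ∎

    arrived′ : ∀ {q} → q ∈ S′ → arrival q ≤ t
    arrived′ q∈S′ with performs-served ps q∈S′
    ... | inj₁ q∈S         = ≤-trans (arrived q∈S) τ≤t
    ... | inj₂ (a≤t , _)   = a≤t

    visited′ : ∀ {q} → q ∈ S′ → q ∉ D → Visits (p₀ ∷ vs′) (location q)
    visited′ q∈S′ q∉D with performs-served ps q∈S′
    ... | inj₁ q∈S           = visits-++ˡ (visited q∈S q∉D)
    ... | inj₂ (_ , vis , _) =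
      visits-++ʳ p₀ vs (subst (λ r → Visits (r ∷ trail cs) _) (sym at-p) vis)

    -- The intervals are chained here. If `q` is served in this action, its age is at most `δ`. If
    -- its earlier witness `u` is served now, then `t` is at most `arrival u + δ`, and `arrival u`
    -- at most `arrival q + C`. Otherwise `u` remains a witness.
    covered′ : ∀ {q} → q ∈ S′ → q ∉ D →
      t ≤ (arrival q + C′) ⊎ ∃ λ u → u ∉ S′ × arrival u ≤ (arrival q + C′)
    covered′ q∈S′ q∉D with performs-served ps q∈S′
    ... | inj₂ (_ , _ , age) = inj₁ (≤-trans age (+-monoʳ-≤ _ (x≤y+x δ 0≤C)))
    ... | inj₁ q∈S with covered q∈S q∉D
    ...   | u , u∉S , u≤ with u ∈? S′
    ...     | no u∉S′ = inj₂
      (u , u∉S′ , ≤-trans u≤ (+-monoʳ-≤ _ (x≤x+y C (delays-nonNegative ps))))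
    ...     | yes u∈S′ with performs-served ps u∈S′
    ...       | inj₁ u∈S           = contradiction u∈S u∉S
    ...       | inj₂ (_ , _ , age) = inj₁
      (≤-trans age (≤-trans (+-monoˡ-≤ δ u≤) (reflexive (+-assoc _ _ _))))

    -- A request that has arrived by `t` and is still unserved is a witness for every `q` whose
    -- chain of intervals reaches `t`.
    postponed : ¬ AllServed t S′ → Deferred t C′ S′ D (p₀ ∷ vs′)
    postponed ¬all = record
      { 0≤C     = 0≤C′
      ; arrived = arrived′
      ; visited = visited′
      ; covered = λ q∈S′ q∉D →
          [ (λ t≤ → _ , v∉S′ , ≤-trans v≤t t≤) , (λ c → c) ]′ (covered′ q∈S′ q∉D)
      }
      where
      v≤t  = proj₁ (proj₂ (someUnserved ¬all))
      v∉S′ = proj₂ (proj₂ (someUnserved ¬all))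

    -- Everything served electively has arrived by `t` and so lies in `D` or in the batch just
    -- served. Nothing is postponed any more, and the credit restarts at zero.
    flushed : ∀ {W} → Deferred t 0# S′ (D ∪ due t D) W
    flushed = record
      { 0≤C     = ≤-refl
      ; arrived = arrived′
      ; visited = λ q∈S′ q∉ → contradiction (handled q∈S′) q∉
      ; covered = λ q∈S′ q∉ → contradiction (handled q∈S′) q∉
      }
      where
      handled : ∀ {q} → q ∈ S′ → q ∈ D ∪ due t D
      handled {q} q∈S′ with q ∈? D
      ... | yes q∈D = x∈p∪q⁺ (inj₁ q∈D)
      ... | no  q∉D = x∈p∪q⁺ (inj₂ (∈⟦⟧⁺ (due? t D) (arrived′ q∈S′ , q∉D)))

    -- When nothing that has arrived is unserved, a witness outside `S′` can only arrive after `t`.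
    -- Either alternative of `covered′` then bounds the age of `q` by `C′`.
    delay≤C′ : AllServed t S′ → maxDelay t (elements (due t D)) ≤ C′
    delay≤C′ all = maxDelay-least _ 0≤C′ λ {q} q∈ →
      let a≤t , q∉D = ∈⟦⟧⁻ (due? t D) (∈-elements⁻ q∈) in
      x≤y+z⇒x-y≤z (young a≤t q∉D)
      where
      young : ∀ {q} → arrival q ≤ t → q ∉ D → t ≤ (arrival q + C′)
      young a≤t q∉D with covered′ (all _ a≤t) q∉D
      ... | inj₁ t≤ = t≤
      ... | inj₂ (u , u∉S′ , u≤) with total (arrival u) t
      ...   | inj₁ u≤t = contradiction (all u u≤t) u∉S′
      ...   | inj₂ t≤u = ≤-trans t≤u u≤

  -- Feasibility and cost of the lazy schedule.

  executes-earlier : ∀ {σ s τ τ′ p S αs S′} → τ ≤ τ′ →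
                     Executes σ s τ′ p S αs S′ → Executes σ s τ p S αs S′
  executes-earlier τ≤τ′ []                  = []
  executes-earlier τ≤τ′ ((τ′≤t , ps) ∷ es) = (≤-trans τ≤τ′ τ′≤t , ps) ∷ es

  -- Service on arrival refers to a whole schedule while the recursion sees a tail, so `ŝ` is kept
  -- fixed. The two implications say that `D` consists of `R` and the requests that `ŝ` serves on
  -- arrival. The cost bound spends the credit of the postponed actions.
  lazy-correct : ∀ {s ŝ τ p S αs S″} (es : Executes elective s τ p S αs S″) →
    (∀ q → q ∈ S″) → ∀ {C D R p₀ vs} →
    Deferred τ C S D (p₀ ∷ vs) → end′ p₀ vs ≡ p →
    (∀ {q} → q ∈ D → ServedOnArrival automatic ŝ q ⊎ q ∈ R) →
    (∀ {q} → ServedOnArrival automatic ŝ q ⊎ q ∈ R → q ∈ D) →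
    (∃ λ R″ → Executes automatic ŝ τ p₀ R (lazy es p₀ vs D) R″
            × (∀ q → ServedOnArrival automatic ŝ q ⊎ q ∈ R″))
    × cost (lazy es p₀ vs D) ≤ ((length′ p₀ vs + C) + cost αs)
  lazy-correct {ŝ = ŝ} [] all {D = D} {R} {p₀} {vs} inv _ D⇒R R⇒D =
    -- At the end every request is served electively. One outside `D` would have an unserved
    -- witness, so `D` is everything and any walk still owed is dropped.
    (R , [] , λ q → D⇒R (decidable-stable (q ∈? D)
                (λ q∉D → let u , u∉S , _ = covered (all q) q∉D in u∉S (all u))))
    , +-nonNegative (+-nonNegative (length′-nonNegative p₀ vs) 0≤C) ≤-refl
    where open Deferred inv
  lazy-correct {ŝ = ŝ} (_∷_ {α = action t cs} {αs = αs} {S′ = S′} (τ≤t , ps) es) all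
               {C} {D} {R} {p₀} {vs} inv at-p D⇒R R⇒D with allServed? t S′
  ... | no ¬served =
    let (R″ , es′ , all′) , cost≤ = lazy-correct es all (postponed ¬served) at-p′ D⇒R R⇒D
    in (R″ , executes-earlier τ≤t es′ , all′)
     , ≤-trans cost≤ (reflexive (budget (cost αs)))
    where open Step ps inv τ≤t at-p
  ... | yes served =
    let (R″ , es′ , all′) , cost≤ = lazy-correct {ŝ = ŝ} es all {R = R ∪ B} flushed at-p′ D⇒R′ R⇒D′
    in (R″ , (τ≤t , ((refl , canServe , forced) ∷ [])) ∷ es′ , all′)
     , (begin
       ((length′ p₀ vs′ + maxDelay t (elements B)) + 0#) + cost (lazy es (end′ p₀ vs′) [] (D ∪ B))
         ≤⟨ +-mono-≤ (reflexive (+-identityʳ _)) cost≤ ⟩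
       -- `0# + 0#` is the credit after the flush: an empty owed walk and no accumulated delay.
       (length′ p₀ vs′ + maxDelay t (elements B)) + ((0# + 0#) + cost αs)
         ≤⟨ +-mono-≤ (+-monoʳ-≤ _ (delay≤C′ served))
              (reflexive (Eq.trans (+-congʳ (+-identityˡ 0#)) (+-identityˡ _))) ⟩
       (length′ p₀ vs′ + C′) + cost αs
         ≈⟨ budget (cost αs) ⟩
       (length′ p₀ vs + C) + (componentsCost t cs + cost αs) ∎)
    where
    open Step ps inv τ≤t at-p

    B : Subset count
    B = due t D

    -- Whatever is due has been served electively, by `served`, and therefore lies on the owed walk.
    canServe : ∀ q → q ∈ B → CanServe automatic ŝ t R (p₀ ∷ vs′) q
    canServe q q∈B with ∈⟦⟧⁻ (due? t D) q∈B
    ... | a≤t , q∉D = pending a≤t (q∉D ∘ R⇒D ∘ inj₁) (q∉D ∘ R⇒D ∘ inj₂)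
                    , visited′ (served q a≤t) q∉D

    forced : Forced automatic ŝ t R (component (p₀ ∷ vs′) B)
    forced q (pending a≤t ¬on q∉R , _) =
      ∈⟦⟧⁺ (due? t D) (a≤t , [ ¬on , q∉R ]′ ∘ D⇒R)

    D⇒R′ : ∀ {q} → q ∈ D ∪ B → ServedOnArrival automatic ŝ q ⊎ q ∈ R ∪ B
    D⇒R′ q∈ with x∈p∪q⁻ D B q∈
    ... | inj₂ q∈B = inj₂ (x∈p∪q⁺ (inj₂ q∈B))
    ... | inj₁ q∈D with D⇒R q∈D
    ...   | inj₁ on  = inj₁ on
    ...   | inj₂ q∈R = inj₂ (x∈p∪q⁺ (inj₁ q∈R))

    R⇒D′ : ∀ {q} → ServedOnArrival automatic ŝ q ⊎ q ∈ R ∪ B → q ∈ D ∪ B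
    R⇒D′ (inj₁ on) = x∈p∪q⁺ (inj₁ (R⇒D (inj₁ on)))
    R⇒D′ (inj₂ q∈) with x∈p∪q⁻ R B q∈
    ... | inj₁ q∈R = x∈p∪q⁺ (inj₁ (R⇒D (inj₂ q∈R)))
    ... | inj₂ q∈B = x∈p∪q⁺ (inj₂ q∈B)

  automate : ∀ s → Feasible elective s → ∃ λ s′ → Feasible automatic s′ × cost s′ ≤ cost s
  automate s (S , es , done) =
    ŝ , feasible , ≤-trans cost≤
      (reflexive (Eq.trans (+-congʳ (+-identityˡ 0#)) (+-identityˡ _)))
    where
    -- The server's positions do not depend on the batches, so they can be read
    -- off a draft that ignores service on arrival.
    draft : Schedule
    draft = lazy es s₀ [] ∅

    onArrival? : Decidable (ServedOnArrival automatic draft)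
    onArrival? = servedOnArrival? automatic draft

    ŝ : Schedule
    ŝ = lazy es s₀ [] ⟦ onArrival? ⟧

    samePosition : ∀ q → positionBefore s₀ ŝ (arrival q) ≡ positionBefore s₀ draft (arrival q)
    samePosition q = lazy-position es s₀ [] _ _ (arrival q)

    correct : (∃ λ R″ → Executes automatic ŝ 0# s₀ ∅ ŝ R″
                      × (∀ q → ServedOnArrival automatic ŝ q ⊎ q ∈ R″))
              × cost ŝ ≤ ((0# + 0#) + cost s)
    correct = lazy-correct es (λ q → [ (λ ()) , (λ q∈S → q∈S) ]′ (done q))
      (record { 0≤C     = ≤-refl
              ; arrived = λ q∈ → contradiction q∈ ∉⊥
              ; visited = λ q∈ → contradiction q∈ ∉⊥
              ; covered = λ q∈ → contradiction q∈ ∉⊥ })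
      refl
      (λ {q} q∈ → inj₁ (trans (∈⟦⟧⁻ onArrival? q∈) (sym (samePosition q))))
      (λ {q} → [ (λ on → ∈⟦⟧⁺ onArrival? (trans on (samePosition q)))
               , (λ q∈ → contradiction q∈ ∉⊥) ]′)

    feasible : Feasible automatic ŝ
    feasible = proj₁ correct

    cost≤ : cost ŝ ≤ ((0# + 0#) + cost s)
    cost≤ = proj₂ correct

  -- From automatic to elective service

  -- Elective service has neither service on arrival nor forced service, so the schedule index may
  -- be exchanged freely. This also re-indexes an execution after an insertion.
  performs-elective : ∀ {σ s s′ t p S cs p′ S′} → Performs σ s t p S cs p′ S′ →
                      Performs elective s′ t p S cs p′ S′
  performs-elective [] = []
  performs-elective ((start , ok , _) ∷ ps) =
    (start
    , (λ q q∈B → let pending a≤t _ q∉S , vis = ok q q∈B in pending a≤t (λ ()) q∉S , vis)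
    , tt) ∷ performs-elective ps

  executes-elective : ∀ {σ s s′ τ p S αs S′} → Executes σ s τ p S αs S′ →
                      Executes elective s′ τ p S αs S′
  executes-elective []                 = []
  executes-elective ((τ≤t , ps) ∷ es) = (τ≤t , performs-elective ps) ∷ executes-elective es

  performs-endOf : ∀ {σ s t p S cs p′ S′} → Performs σ s t p S cs p′ S′ → endOf p cs ≡ p′
  performs-endOf []                = refl
  performs-endOf ((refl , _) ∷ ps) = performs-endOf ps

  -- Serving `q` earlier does no harm to the later batches: one that contains `q` would put it into
  -- `S′`.
  performs-include : ∀ {s t p S cs p′ S′ q} → Performs elective s t p S cs p′ S′ → q ∉ S′ →
                     Performs elective s t p (S ∪ ⁅ q ⁆) cs p′ (S′ ∪ ⁅ q ⁆)
  performs-include [] _ = []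
  performs-include {s} {t} {S = S} {q = q} (_∷_ {c = c} {cs} {p′} {S′} (start , ok , _) ps) q∉S′ =
    (start , canServe , tt)
    ∷ subst (λ X → Performs elective s t (end (walk c)) X cs p′ (S′ ∪ ⁅ q ⁆))
        (∪-swapʳ S (batch c) ⁅ q ⁆) (performs-include ps q∉S′)
    where
    canServe : ∀ r → r ∈ batch c → CanServe elective s t (S ∪ ⁅ q ⁆) (walk c) r
    canServe r r∈B with ok r r∈B
    ... | pending a≤t _ r∉S , vis = pending a≤t (λ ()) r∉S∪q , vis
      where
      r∉S∪q : r ∉ S ∪ ⁅ q ⁆
      r∉S∪q r∈ with x∈p∪q⁻ S ⁅ q ⁆ r∈
      ... | inj₁ r∈S = r∉S r∈S
      ... | inj₂ r∈q with x∈⁅y⁆⇒x≡y q r∈q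
      ...   | refl = q∉S′ (performs-mono ps (x∈p∪q⁺ (inj₂ r∈B)))

  executes-mono : ∀ {s τ p S αs S′} → Executes elective s τ p S αs S′ → S ⊆ S′
  executes-mono []              q∈S = q∈S
  executes-mono ((_ , ps) ∷ es) q∈S = executes-mono es (performs-mono ps q∈S)

  executes-include : ∀ {s τ p S αs S′ q} → Executes elective s τ p S αs S′ → q ∉ S′ →
                     Executes elective s τ p (S ∪ ⁅ q ⁆) αs (S′ ∪ ⁅ q ⁆)
  executes-include []                 _    = []
  executes-include ((τ≤t , ps) ∷ es) q∉S′ =
    (τ≤t , performs-include ps (q∉S′ ∘ executes-mono es)) ∷ executes-include es q∉S′

  -- Insertion of stops at no cost.

  serveAt : Point → Request → Action
  serveAt p q = action (arrival q) (component (p ∷ []) ⁅ q ⁆ ∷ [])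

  -- The test is that of `positionBefore`, so the stop is made where the epoch finds the server; in
  -- a tie it precedes the action.
  insert : Request → Point → Schedule → Schedule
  insert q p []       = serveAt p q ∷ []
  insert q p (α ∷ αs) with arrival q ≤? time α
  ... | yes _ = serveAt p q ∷ α ∷ αs
  ... | no _  = α ∷ insert q (endOf p (components α)) αs

  cost-serveAt : ∀ p q → cost (serveAt p q ∷ []) ≤ 0#
  cost-serveAt p q = begin
    ((0# + maxDelay (arrival q) (elements ⁅ q ⁆)) + 0#) + 0#
      ≈⟨ Eq.trans (+-identityʳ _) (Eq.trans (+-identityʳ _) (+-identityˡ _)) ⟩
    maxDelay (arrival q) (elements ⁅ q ⁆)
      ≤⟨ maxDelay-least _ ≤-refl (λ r∈ → noDelay (x∈⁅y⁆⇒x≡y q (∈-elements⁻ r∈))) ⟩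
    0# ∎
    where
    noDelay : ∀ {r} → r ≡ q → (arrival q - arrival r) ≤ 0#
    noDelay refl = reflexive (-‿inverseʳ _)

  cost-insert : ∀ q p αs → cost (insert q p αs) ≤ cost αs
  cost-insert q p [] = cost-serveAt p q
  cost-insert q p (α ∷ αs) with arrival q ≤? time α
  ... | no _  = +-monoʳ-≤ _ (cost-insert q _ αs)
  ... | yes _ = begin
    componentsCost (arrival q) (components (serveAt p q)) + cost (α ∷ αs)
      ≤⟨ +-monoˡ-≤ _ (≤-trans (reflexive (Eq.sym (+-identityʳ _))) (cost-serveAt p q)) ⟩
    0# + cost (α ∷ αs)
      ≈⟨ +-identityˡ _ ⟩
    cost (α ∷ αs) ∎

  insert-position : ∀ q p αs θ → positionBefore p (insert q p αs) θ ≡ positionBefore p αs θ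
  insert-position q p [] θ with θ ≤? arrival q
  ... | yes _ = refl
  ... | no _  = refl
  insert-position q p (α ∷ αs) θ with arrival q ≤? time α
  ... | no _  = cong (if does (θ ≤? time α) then p else_) (insert-position q _ αs θ)
  ... | yes a≤t with θ ≤? arrival q
  ...   | no _    = refl
  -- Both schedules stop at `p`: the new one before the inserted stop, the old one before `α`, since
  -- `θ` is also at most `time α`.
  ...   | yes θ≤a rewrite dec-true (θ ≤? time α) (≤-trans θ≤a a≤t) = refl

  serveAt-performs : ∀ {s p S q} → q ∉ S → location q ≡ p →
    Performs elective s (arrival q) p S (components (serveAt p q)) p (S ∪ ⁅ q ⁆)
  serveAt-performs {q = q} q∉S here-q =
    (refl , (λ r r∈ → canServe (x∈⁅y⁆⇒x≡y q r∈)) , tt) ∷ []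
    where
    canServe : ∀ {r} → r ≡ q → CanServe elective _ (arrival q) _ (_ ∷ []) r
    canServe refl = pending ≤-refl (λ ()) q∉S , here here-q

  insert-executes : ∀ {s τ p S αs S′ q} → Executes elective s τ p S αs S′ →
    q ∉ S′ → τ ≤ arrival q → location q ≡ positionBefore p αs (arrival q) →
    Executes elective s τ p S (insert q p αs) (S′ ∪ ⁅ q ⁆)
  insert-executes [] q∉S′ τ≤a at = (τ≤a , serveAt-performs q∉S′ at) ∷ []
  insert-executes {q = q} (_∷_ {α = α} (τ≤t , ps) es) q∉S′ τ≤a at with arrival q ≤? time α
  ... | yes a≤t =
    (τ≤a , serveAt-performs (q∉S′ ∘ executes-mono ((τ≤t , ps) ∷ es)) at)
    ∷ executes-include ((a≤t , ps) ∷ es) q∉S′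
  ... | no a≰t with performs-endOf ps
  ...   | refl = (τ≤t , ps) ∷ insert-executes es q∉S′ t≤a at
    where
    t≤a : time α ≤ arrival q
    t≤a = [ (λ t≤ → t≤) , (λ a≤t → contradiction a≤t a≰t) ]′ (total (time α) (arrival q))

  electify : ∀ s → Feasible automatic s → ∃ λ s′ → Feasible elective s′ × cost s′ ≤ cost s
  electify s (S , es , done) =
    let s′ , S′ , es′ , cost≤ , _ , S⊆S′ , served = serve (allFin count) in
    s′
    , (S′ , es′ , λ q → inj₂ ([ served (∈-allFin q) , S⊆S′ ]′ (done q)))
    , cost≤
    where
    -- Equality of positions is carried along because service on arrival is stated for `s`, while
    -- the next stop is inserted into `s′`.
    serve : ∀ qs → ∃ λ s′ → ∃ λ S′ →
      Executes elective s′ 0# s₀ ∅ s′ S′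
      × cost s′ ≤ cost s
      × (∀ θ → positionBefore s₀ s′ θ ≡ positionBefore s₀ s θ)
      × S ⊆ S′
      × (∀ {q} → q List.∈ qs → ServedOnArrival automatic s q → q ∈ S′)
    serve [] = s , S , executes-elective es , ≤-refl , (λ _ → refl) , (λ q∈ → q∈) , λ ()
    serve (q ∷ qs) with serve qs
    ... | s′ , S′ , es′ , cost≤ , pos , S⊆S′ , served
      with q ∈? S′ | servedOnArrival? automatic s q
    ...   | yes q∈S′ | _ = s′ , S′ , es′ , cost≤ , pos , S⊆S′
      , λ { (here refl) _ → q∈S′ ; (there q∈) → served q∈ }
    ...   | no _ | no ¬on = s′ , S′ , es′ , cost≤ , pos , S⊆S′
      , λ { (here refl) on → contradiction on ¬on ; (there q∈) → served q∈ }
    ...   | no q∉S′ | yes on =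
      insert q s₀ s′ , S′ ∪ ⁅ q ⁆
      , executes-elective
          (insert-executes es′ q∉S′ (arrival≥0 q) (trans on (sym (pos (arrival q)))))
      , ≤-trans (cost-insert q s₀ s′) cost≤
      , (λ θ → trans (insert-position q s₀ s′ θ) (pos θ))
      , p⊆p∪q ⁅ q ⁆ ∘ S⊆S′
      , λ { (here refl) _ → x∈p∪q⁺ (inj₂ (x∈⁅x⁆ q))
          ; (there q∈) on′ → p⊆p∪q ⁅ q ⁆ (served q∈ on′) }

  -- Comparison of the two infima.

  OPT-mono : ∀ σ σ′ →
    (∀ s → Feasible σ′ s → ∃ λ s′ → Feasible σ s′ × cost s′ ≤ cost s) → OPT σ ≤ OPT σ′
  OPT-mono σ σ′ simulate = proj₂ (proj₂ (optimum σ′)) (OPT σ) λ x (s , feasible , x≈) →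
    let s′ , feasible′ , cost≤ = simulate s feasible in
    ≤-trans (proj₁ (proj₂ (optimum σ)) (cost s′) (s′ , feasible′ , Eq.refl))
      (≤-trans cost≤ (reflexive (Eq.sym x≈)))

  OPT-automatic≈OPT-elective : OPT automatic ≈ OPT elective
  OPT-automatic≈OPT-elective =
    antisym (OPT-mono automatic elective automate) (OPT-mono elective automatic electify)

theorem4p9 :
    (ℝ : Reals) (M : FiniteMetricSpace ℝ) (s₀ : FiniteMetricSpace.Point M) (I : Input ℝ M) →
    let open Reals ℝ using (_≈_)
        open Model ℝ M s₀ I using (OPT)
    in OPT automatic ≈ OPT elective
theorem4p9 = OPT-automatic≈OPT-elective
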